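{- Let $M$ be a planar map whose underlying graph contains a subdivision of $K_{2,3}$ (as a subgraph). Then $\dim(\mathbf{P}_{VEF}(M)) > 3$.
   Context: A planar map $M=(G,D)$ consists of a finite planar multigraph $G$ together with a plane drawing $D$ of $G$; it determines the set $V$ of vertices, the set $E$ of edges, the set $F$ of faces and the incidence relations among them. The vertex-edge-face poset $\mathbf{P}_{VEF}(M)$ is the poset on $V\cup E\cup F$ ordered by incidence/inclusion (a vertex is below each edge of which it is an endpoint and below each face on whose boundary it lies; an edge is below each face on whose boundary it lies). The dimension of a finite poset is the minimum number of linear orders on its ground set whose intersection is the poset's order. -}

module Defs where

open import Data.Nat using (ℕ; zero; suc; _+_; _*_)
open import Data.Fin using (Fin; zero; suc; inject₁; fromℕ)
open import Data.Sum using (_⊎_; inj₁; inj₂)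
open import Data.Product using (Σ; ∃; ∃₂; _×_; _,_)
open import Data.Empty using (⊥)
open import Relation.Nullary using (¬_)
open import Relation.Binary.PropositionalEquality using (_≡_; _≢_)
open import Relation.Binary.Structures using (IsTotalOrder)
open import Relation.Binary.Construct.Closure.ReflexiveTransitive using (Star)
open import Function.Bundles using (_⇔_)

iter : {A : Set} → (A → A) → ℕ → A → A
iter f zero    x = x
iter f (suc k) x = f (iter f k x)

SameOrbit : {A : Set} → (A → A) → A → A → Set
SameOrbit f x y = ∃ λ k → iter f k x ≡ y

-- Planar maps (plane drawings of finite multigraphs, up to homeomorphism),
-- encoded combinatorially.  Each connected component with at least one edge
-- is a combinatorial map (darts, fixed-point-free involution α, rotation σ);
-- vertices = σ-orbits, edges = α-orbits, "local" faces of a component =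
-- orbits of σ ∘ α; an isolated vertex has one local face.  Genus 0 of every
-- component is forced by the global Euler relation V + L = E + 2C (each
-- component satisfies V - E + L ≤ 2).

record PlanarMap : Set₁ where
  field
    nV nE nD nL nF nC : ℕ
    α σ σ⁻¹ : Fin nD → Fin nD
    α-invol : ∀ x → α (α x) ≡ x
    α-fpf   : ∀ x → α x ≢ x
    σσ⁻¹    : ∀ x → σ (σ⁻¹ x) ≡ x
    σ⁻¹σ    : ∀ x → σ⁻¹ (σ x) ≡ x
    -- vertices: σ-orbits of darts, plus isolated vertices
    vert      : Fin nD → Fin nV
    vert-orb  : ∀ x y → (vert x ≡ vert y) ⇔ SameOrbit σ x y
    edge      : Fin nD → Fin nE
    edge-surj : ∀ e → ∃ λ x → edge x ≡ e
    edge-orb  : ∀ x y → (edge x ≡ edge y) ⇔ (y ≡ x ⊎ y ≡ α x)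
    lf        : Fin nD → Fin nL
    lf-orb    : ∀ x y → (lf x ≡ lf y) ⇔ SameOrbit (λ z → σ (α z)) x y
    lfIso     : (v : Fin nV) → (∀ x → vert x ≢ v) → Fin nL
    lfIso-inj : ∀ v i w j → (v ≡ w) ⇔ (lfIso v i ≡ lfIso w j)
    lf-lfIso  : ∀ x v i → lf x ≢ lfIso v i
    lf-surj   : ∀ l → (∃ λ x → lf x ≡ l) ⊎ (∃₂ λ v i → lfIso v i ≡ l)
    comp      : Fin nV → Fin nC
    comp-surj : ∀ c → ∃ λ v → comp v ≡ c
    comp-conn : ∀ u w → (comp u ≡ comp w) ⇔
                  Star (λ a b → ∃ λ x → vert x ≡ a × vert (α x) ≡ b) u w
    -- every component is a plane (genus 0) map: Euler's relation
    euler     : nV + nL ≡ nE + 2 * nC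
    gf        : Fin nL → Fin nF
    gf-surj   : ∀ f → ∃ λ l → gf l ≡ f

  Touches : Fin nC → Fin nF → Set
  Touches c f = (∃ λ x → comp (vert x) ≡ c × gf (lf x) ≡ f)
              ⊎ (∃₂ λ v i → comp v ≡ c × gf (lfIso v i) ≡ f)

  BStep : Fin nC ⊎ Fin nF → Fin nC ⊎ Fin nF → Set
  BStep (inj₁ c) (inj₂ f) = Touches c f
  BStep (inj₂ f) (inj₁ c) = Touches c f
  BStep _        _        = ⊥

record IsPlanarMap (M : PlanarMap) : Set where
  open PlanarMap M
  field
    -- the component / global-face incidence multigraph (edges = local faces)
    -- is a tree: connected, and #edges = #nodes - 1
    tree-conn  : ∀ p q → Star BStep p q
    tree-count : nL + 1 ≡ nC + nF

module _ (M : PlanarMap) where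
  open PlanarMap M

  VEF : Set
  VEF = Fin nV ⊎ Fin nE ⊎ Fin nF

  VertFace : Fin nV → Fin nF → Set
  VertFace v f = (∃ λ x → vert x ≡ v × gf (lf x) ≡ f)
               ⊎ (∃ λ i → gf (lfIso v i) ≡ f)

  _≤VEF_ : VEF → VEF → Set
  inj₁ v        ≤VEF inj₁ v'        = v ≡ v'
  inj₁ v        ≤VEF inj₂ (inj₁ e)  = ∃ λ x → vert x ≡ v × edge x ≡ e
  inj₁ v        ≤VEF inj₂ (inj₂ f)  = VertFace v f
  inj₂ (inj₁ e) ≤VEF inj₂ (inj₁ e') = e ≡ e'
  inj₂ (inj₁ e) ≤VEF inj₂ (inj₂ f)  = ∃ λ x → edge x ≡ e × gf (lf x) ≡ f
  inj₂ (inj₂ f) ≤VEF inj₂ (inj₂ f') = f ≡ f'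
  _             ≤VEF _              = ⊥

DimAtMost : (G : Set) → (G → G → Set) → ℕ → Set₁
DimAtMost G _≤_ k =
  Σ (Fin k → G → G → Set) λ L →
    (∀ i → IsTotalOrder _≡_ (L i)) ×
    (∀ x y → (x ≤ y) ⇔ (∀ i → L i x y))

module _ (M : PlanarMap) where
  open PlanarMap M

  record Path (s t : Fin nV) : Set where
    field
      len   : ℕ
      darts : Fin len → Fin nD
      vtx   : Fin (suc len) → Fin nV
      tail  : ∀ i → vert (darts i) ≡ vtx (inject₁ i)
      head  : ∀ i → vert (α (darts i)) ≡ vtx (suc i)
      vinj  : ∀ i j → vtx i ≡ vtx j → i ≡ j
      start : vtx zero ≡ s
      end   : vtx (fromℕ len) ≡ t

  OnPath : ∀ {s t} → Path s t → Fin nV → Set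
  OnPath P w = ∃ λ k → Path.vtx P k ≡ w

  record SubdivK23 : Set where
    field
      a : Fin 2 → Fin nV
      b : Fin 3 → Fin nV
      a-inj : ∀ i i' → a i ≡ a i' → i ≡ i'
      b-inj : ∀ j j' → b j ≡ b j' → j ≡ j'
      a≢b   : ∀ i j → a i ≢ b j
      P     : (i : Fin 2) (j : Fin 3) → Path (a i) (b j)
      internal : ∀ i j w → OnPath (P i j) w → w ≢ a i → w ≢ b j →
        (∀ i' → w ≢ a i') × (∀ j' → w ≢ b j') ×
        (∀ i' j' → ¬ (i' ≡ i × j' ≡ j) → ¬ OnPath (P i' j') w)

{-# OPTIONS --safe #-}
-- Let p (x , y) and q (x , y) say whether x lies above y in the first and in
-- the second of three linear orders realizing the poset.  Order the pairs
-- (x , y) by raising x and lowering y.  Between incomparable pairs, p and q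
-- cannot both change along this order (the third order would have to make one
-- of the pairs comparable), so "p dq" is a closed 1-form modulo 2 on the space
-- of incomparable pairs, that is, on two points moving in the map without
-- meeting.  Exchanging a₀ and a₁ along two of the three paths of the theta
-- graph, with the first point waiting at b j while the second one passes
-- through b k, gives an integral r j k ∈ 𝔽₂.  It does not depend on k, because
-- the cycle formed by the two paths avoiding b j bounds a set of faces avoiding
-- b j.  On the other hand r k j = r j k + 1, because interchanging the two
-- points turns p into 1 + p and ∫ dq = 1.  So r takes three pairwise distinct
-- values in 𝔽₂.
--
-- That every cycle bounds follows from Euler's formula by counting unknowns and
-- equations in a linear system over 𝔽₂.

module Submission where

open import Defs
open import Algebra.Bundles using (CommutativeRing)
open import Data.Bool.Base using (Bool; true; false; not; _∧_; _xor_)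
open import Data.Bool.Properties using (xor-∧-commutativeRing; xor-same; xor-comm; xor-identityʳ; ∧-zeroʳ; ∧-comm; ∧-distribˡ-xor; ∧-distribʳ-xor; not-¬; ¬-not)
open import Data.Bool.Solver using (module xor-∧-Solver)
open import Data.Empty using (⊥; ⊥-elim)
open import Data.Fin.Base using (Fin; zero; suc; inject₁; fromℕ; finToFun; funToFin; combine)
open import Data.Fin.Patterns using (0F; 1F; 2F)
open import Data.Fin.Permutation using (Permutation; permutation)
open import Data.Fin.Properties using (_≟_; 2↔Bool; pigeonhole; finToFun-funToFin; funToFin-finToFin; <⇒≢; +↔⊎)
open import Data.Nat.Base using (ℕ; zero; suc; _+_; _*_; _^_; _<_; s≤s; z≤n)
open import Data.Nat.Properties using (≤-reflexive; ^-monoʳ-<; +-cancelʳ-≡)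
open import Data.Nat.Solver using (module +-*-Solver)
open import Data.Product using (∃; _×_; _,_; proj₁; proj₂)
open import Data.Sum.Base using (_⊎_; inj₁; inj₂)
open import Data.Sum.Properties using (≡-dec)
open import Data.Sum.Function.Propositional using (_⊎-↔_)
open import Function.Base using (_∘_)
open import Function.Bundles using (mk⇔; _↔_; Equivalence; Inverse; Injection)
open import Function.Construct.Composition using (_↔-∘_)
open import Function.Construct.Identity using (↔-id)
open import Function.Properties.Inverse using (↔⇒↣; ↔-sym)
open import Relation.Binary.Construct.Closure.ReflexiveTransitive using (Star; ε; _◅_)
open import Relation.Binary.Definitions using (DecidableEquality)
open import Relation.Binary.PropositionalEquality
open import Relation.Binary.Structures using (IsTotalOrder)
open import Relation.Nullary using (¬_; Dec; does; yes; no; contradiction)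
open import Relation.Nullary.Decidable using (dec-true; dec-false; does-⇔)

open import Algebra.Properties.Semiring.Sum (CommutativeRing.semiring xor-∧-commutativeRing)
  using (sum-syntax; sum-cong-≗; sum-replicate-zero; ∑-distrib-+; ∑-comm; ∑-permute; *-distribˡ-sum; *-distribʳ-sum)

-- Sums modulo 2

∑-zero : ∀ {n} (g : Fin n → Bool) → (∀ i → g i ≡ false) → ∑[ i < n ] g i ≡ false
∑-zero {n} g g≡0 = trans (sum-cong-≗ g≡0) (sum-replicate-zero n)

∑-δ : ∀ {n} (a : Fin n) (g : Fin n → Bool) → ∑[ i < n ] (does (i ≟ a) ∧ g i) ≡ g a
∑-δ {suc n} zero    g = trans (cong (g zero xor_) (sum-replicate-zero n)) (xor-identityʳ (g zero))
∑-δ {suc n} (suc a) g = ∑-δ a (g ∘ suc)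

∑-telescope : ∀ n (g : Fin (suc n) → Bool) →
  ∑[ i < n ] (g (inject₁ i) xor g (suc i)) ≡ g zero xor g (fromℕ n)
∑-telescope zero    g = sym (xor-same (g zero))
∑-telescope (suc n) g = trans (cong ((g zero xor g (suc zero)) xor_) (∑-telescope n (g ∘ suc)))
  (solve 3 (λ x y z → (x :+ y) :+ (y :+ z) := x :+ z) refl (g zero) (g (suc zero)) (g (suc (fromℕ n))))
  where open xor-∧-Solver

xor≡false⇒≡ : ∀ {x y} → x xor y ≡ false → x ≡ y
xor≡false⇒≡ {true}  {true}  _ = refl
xor≡false⇒≡ {false} {false} _ = refl

-- With `a`, `b` two values of `p` and `c xor d` a change of `q`, the coefficients have to agree
-- only where `q` really changes, in a known direction.
∧-xor-cong : ∀ {a b c d} → (c ≡ false → d ≡ true → a ≡ b) → (c ≡ true → d ≡ false → a ≡ b) →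
  a ∧ (c xor d) ≡ b ∧ (c xor d)
∧-xor-cong {a} {b} {true}  {true}  _ _ = trans (∧-zeroʳ a) (sym (∧-zeroʳ b))
∧-xor-cong {a} {b} {false} {false} _ _ = trans (∧-zeroʳ a) (sym (∧-zeroʳ b))
∧-xor-cong {a} {b} {true}  {false} _ h = cong (_∧ true) (h refl refl)
∧-xor-cong {a} {b} {false} {true}  h _ = cong (_∧ true) (h refl refl)

-- Linear algebra over the two-element field

funToFin-cong : ∀ {m n} {f g : Fin m → Fin n} → f ≗ g → funToFin f ≡ funToFin g
funToFin-cong {zero}  f≗g = refl
funToFin-cong {suc m} f≗g = cong₂ combine (f≗g zero) (funToFin-cong (f≗g ∘ suc))

module _ {A B : Set} {m n : ℕ} (A-size : Fin m ↔ A) (B-size : Fin n ↔ B) where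
  private
    module A = Inverse A-size
    module B = Inverse B-size
    module 𝔹 = Inverse 2↔Bool

    decode : Fin (2 ^ m) → A → Bool
    decode k a = 𝔹.to (finToFun k (A.from a))

    encode : (B → Bool) → Fin (2 ^ n)
    encode h = funToFin (𝔹.from ∘ h ∘ B.to)

    decode-injective : ∀ {i j} → decode i ≗ decode j → i ≡ j
    decode-injective {i} {j} eq = begin
      i                              ≡⟨ funToFin-finToFin {m} {2} i ⟨
      funToFin (finToFun {2} {m} i)  ≡⟨ funToFin-cong same ⟩
      funToFin (finToFun {2} {m} j)  ≡⟨ funToFin-finToFin {m} {2} j ⟩
      j                              ∎
      where
      open ≡-Reasoning
      same : finToFun {2} {m} i ≗ finToFun {2} {m} j
      same x = Injection.injective (↔⇒↣ 2↔Bool) (subst (λ y → 𝔹.to (finToFun i y) ≡ 𝔹.to (finToFun j y))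
                              (A.strictlyInverseʳ x) (eq (A.to x)))

    encode-injective : ∀ {g h} → encode g ≡ encode h → g ≗ h
    encode-injective {g} {h} eq b = begin
      g b                  ≡⟨ cong g (B.strictlyInverseˡ b) ⟨
      g (B.to (B.from b))  ≡⟨ Injection.injective (↔⇒↣ (↔-sym 2↔Bool)) (trans (sym (finToFun-funToFin _ (B.from b)))
                                (trans (cong (λ k → finToFun k (B.from b)) eq) (finToFun-funToFin _ (B.from b)))) ⟩
      h (B.to (B.from b))  ≡⟨ cong h (B.strictlyInverseˡ b) ⟩
      h b                  ∎
      where open ≡-Reasoning

  -- Among `2 ^ m` assignments two distinct ones share one of the `2 ^ n` possible images, and by
  -- additivity their difference lies in the kernel. Passing to codes lets the pigeonhole principle
  -- apply and keeps function extensionality out.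
  nontrivial-kernel : n < m → (Φ : (A → Bool) → B → Bool) →
    (∀ g h b → Φ (λ a → g a xor h a) b ≡ Φ g b xor Φ h b) →
    ∃ λ g → ¬ (∀ a → g a ≡ false) × (∀ b → Φ g b ≡ false)
  nontrivial-kernel n<m Φ linear
    with i , j , i<j , eq ← pigeonhole (^-monoʳ-< 2 (s≤s (s≤s z≤n)) n<m) (encode ∘ Φ ∘ decode)
    = (λ a → decode i a xor decode j a)
    , (λ zero → <⇒≢ i<j (decode-injective (xor≡false⇒≡ ∘ zero)))
    , λ b → trans (linear (decode i) (decode j) b)
        (trans (cong (_xor Φ (decode j) b) (encode-injective {Φ (decode i)} {Φ (decode j)} eq b)) (xor-same (Φ (decode j) b)))

-- Darts, edges and faces of a planar map

module Homology (M : PlanarMap) where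
  open PlanarMap M

  face : Fin nD → Fin nF
  face d = gf (lf d)

  vert-σ : ∀ d → vert (σ d) ≡ vert d
  vert-σ d = sym (Equivalence.from (vert-orb d (σ d)) (1 , refl))

  -- `σ ∘ α` sends `α d` to `σ d`, so the next dart around the vertex borders the face across the
  -- edge of `d`.
  face-σ : ∀ d → face (σ d) ≡ face (α d)
  face-σ d = cong gf (sym (Equivalence.from (lf-orb (α d) (σ d)) (1 , cong σ (α-invol d))))

  σ-perm : Permutation nD nD
  σ-perm = permutation σ σ⁻¹ σσ⁻¹ σ⁻¹σ

  σα-perm : Permutation nD nD
  σα-perm = permutation (σ ∘ α) (α ∘ σ⁻¹)
    (λ x → trans (cong σ (α-invol _)) (σσ⁻¹ x)) (λ x → trans (cong α (σ⁻¹σ _)) (α-invol x))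

  edge-α : ∀ d → edge (α d) ≡ edge d
  edge-α d = sym (Equivalence.from (edge-orb d (α d)) (inj₂ refl))

  dartOf : Fin nE → Fin nD
  dartOf e = proj₁ (edge-surj e)

  edge-dartOf : ∀ e → edge (dartOf e) ≡ e
  edge-dartOf e = proj₂ (edge-surj e)

  -- `dartOf` picks one of the two darts of an edge arbitrarily; a function invariant under `α`
  -- cannot see the choice.
  dartOf-edge : {A : Set} (g : Fin nD → A) → (∀ d → g (α d) ≡ g d) → ∀ d → g (dartOf (edge d)) ≡ g d
  dartOf-edge g gα d with Equivalence.to (edge-orb d (dartOf (edge d))) (sym (edge-dartOf (edge d)))
  ... | inj₁ eq = cong g eq
  ... | inj₂ eq = trans (cong g eq) (gα d)

  same-edge : ∀ x d → does (edge x ≟ edge d) ≡ does (d ≟ x) xor does (d ≟ α x)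
  same-edge x d with d ≟ x
  ... | yes refl = trans (dec-true (edge x ≟ edge x) refl)
                     (cong not (sym (dec-false (x ≟ α x) (α-fpf x ∘ sym))))
  ... | no d≢x with d ≟ α x
  ...   | yes refl = dec-true (edge x ≟ edge (α x)) (sym (edge-α x))
  ...   | no d≢αx = dec-false (edge x ≟ edge d) λ eq → elim (Equivalence.to (edge-orb x d) eq)
    where
    elim : ¬ (d ≡ x ⊎ d ≡ α x)
    elim (inj₁ d≡x)  = d≢x d≡x
    elim (inj₂ d≡αx) = d≢αx d≡αx

  ∑-edge : ∀ x (g : Fin nD → Bool) → ∑[ d < nD ] (does (edge x ≟ edge d) ∧ g d) ≡ g x xor g (α x)
  ∑-edge x g = begin
    ∑[ d < nD ] (does (edge x ≟ edge d) ∧ g d)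
      ≡⟨ sum-cong-≗ (λ d → trans (cong (_∧ g d) (same-edge x d)) (∧-distribʳ-xor (g d) (does (d ≟ x)) _)) ⟩
    ∑[ d < nD ] ((does (d ≟ x) ∧ g d) xor (does (d ≟ α x) ∧ g d))
      ≡⟨ ∑-distrib-+ (λ d → does (d ≟ x) ∧ g d) _ ⟩
    (∑[ d < nD ] (does (d ≟ x) ∧ g d)) xor (∑[ d < nD ] (does (d ≟ α x) ∧ g d))
      ≡⟨ cong₂ _xor_ (∑-δ x g) (∑-δ (α x) g) ⟩
    g x xor g (α x) ∎
    where open ≡-Reasoning

  ∑-darts : (g : Fin nD → Bool) → ∑[ e < nE ] (g (dartOf e) xor g (α (dartOf e))) ≡ ∑[ d < nD ] g d
  ∑-darts g = begin
    ∑[ e < nE ] (g (dartOf e) xor g (α (dartOf e)))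
      ≡⟨ sum-cong-≗ (λ e → trans (sym (∑-edge (dartOf e) g))
           (sum-cong-≗ λ d → cong (_∧ g d) (cong (λ e → does (e ≟ edge d)) (edge-dartOf e)))) ⟩
    ∑[ e < nE ] ∑[ d < nD ] (does (e ≟ edge d) ∧ g d)
      ≡⟨ ∑-comm (λ e d → does (e ≟ edge d) ∧ g d) ⟩
    ∑[ d < nD ] ∑[ e < nE ] (does (e ≟ edge d) ∧ g d)
      ≡⟨ sum-cong-≗ (λ d → ∑-δ (edge d) λ _ → g d) ⟩
    ∑[ d < nD ] g d ∎
    where open ≡-Reasoning

  -- Chains modulo 2: boundaries of edge sets and of face sets

  EdgeChain : Set
  EdgeChain = Fin nE → Bool

  -- The boundary modulo 2. Summing over darts counts both ends of an edge, so a loop cancels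
  -- itself.
  ∂ : EdgeChain → Fin nV → Bool
  ∂ ξ v = ∑[ d < nD ] (does (vert d ≟ v) ∧ ξ (edge d))

  ∂-cong : ∀ {ξ η} → ξ ≗ η → ∂ ξ ≗ ∂ η
  ∂-cong eq v = sum-cong-≗ λ d → cong (does (vert d ≟ v) ∧_) (eq (edge d))

  ∂-xor : ∀ ξ η v → ∂ (λ e → ξ e xor η e) v ≡ ∂ ξ v xor ∂ η v
  ∂-xor ξ η v = trans (sum-cong-≗ λ d → ∧-distribˡ-xor (does (vert d ≟ v)) _ _)
    (∑-distrib-+ (λ d → does (vert d ≟ v) ∧ ξ (edge d)) _)

  ∂-scale : ∀ c ξ v → ∂ (λ e → c ∧ ξ e) v ≡ c ∧ ∂ ξ v
  ∂-scale true  ξ v = refl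
  ∂-scale false ξ v = ∑-zero (λ d → does (vert d ≟ v) ∧ false) λ d → ∧-zeroʳ (does (vert d ≟ v))

  ∂-∑ : ∀ {n} (ξ : Fin n → EdgeChain) v → ∂ (λ e → ∑[ i < n ] ξ i e) v ≡ ∑[ i < n ] ∂ (ξ i) v
  ∂-∑ ξ v = trans (sum-cong-≗ λ d → *-distribˡ-sum (does (vert d ≟ v)) (λ i → ξ i (edge d)))
    (∑-comm λ d i → does (vert d ≟ v) ∧ ξ i (edge d))

  ∂-edge : ∀ x v → ∂ (λ e → does (edge x ≟ e)) v ≡ does (vert x ≟ v) xor does (vert (α x) ≟ v)
  ∂-edge x v = trans (sum-cong-≗ λ d → ∧-comm (does (vert d ≟ v)) _) (∑-edge x λ d → does (vert d ≟ v))

  -- The boundary of a set of faces: the edges with exactly one side in `s`.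
  δ : (Fin nF → Bool) → EdgeChain
  δ s e = s (face (dartOf e)) xor s (face (α (dartOf e)))

  δ-edge : ∀ s d → δ s (edge d) ≡ s (face d) xor s (face (α d))
  δ-edge s = dartOf-edge (λ d → s (face d) xor s (face (α d)))
    λ d → trans (xor-comm (s (face (α d))) _) (cong (λ x → s (face x) xor s (face (α d))) (α-invol d))

  -- Turning around v, the faces on the two sides of the darts at v are the same faces.
  ∂δ≡0 : ∀ s v → ∂ (δ s) v ≡ false
  ∂δ≡0 s v = begin
    ∑[ d < nD ] (does (vert d ≟ v) ∧ δ s (edge d))
      ≡⟨ sum-cong-≗ split ⟩
    ∑[ d < nD ] (g d xor g (σ d))
      ≡⟨ ∑-distrib-+ g (g ∘ σ) ⟩
    (∑[ d < nD ] g d) xor (∑[ d < nD ] g (σ d))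
      ≡⟨ cong ((∑[ d < nD ] g d) xor_) (∑-permute g σ-perm) ⟨
    (∑[ d < nD ] g d) xor (∑[ d < nD ] g d)
      ≡⟨ xor-same (∑[ d < nD ] g d) ⟩
    false ∎
    where
    open ≡-Reasoning
    g : Fin nD → Bool
    g d = does (vert d ≟ v) ∧ s (face d)
    split : ∀ d → does (vert d ≟ v) ∧ δ s (edge d) ≡ g d xor g (σ d)
    split d = trans (cong (does (vert d ≟ v) ∧_) (δ-edge s d))
      (trans (∧-distribˡ-xor (does (vert d ≟ v)) _ _)
        (cong (g d xor_) (cong₂ (λ u f → does (u ≟ v) ∧ s f) (sym (vert-σ d)) (sym (face-σ d)))))

  -- Vanishing first homology

  Adjacent : Fin nV → Fin nV → Set
  Adjacent u w = ∃ λ x → vert x ≡ u × vert (α x) ≡ w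

  walkChain : ∀ {u w} → Star Adjacent u w → EdgeChain
  walkChain ε             e = false
  walkChain ((x , _) ◅ p) e = does (edge x ≟ e) xor walkChain p e

  ∂-walkChain : ∀ {u w} (p : Star Adjacent u w) v → ∂ (walkChain p) v ≡ does (u ≟ v) xor does (w ≟ v)
  ∂-walkChain {u} ε v = trans (∂-scale false (λ _ → false) v) (sym (xor-same (does (u ≟ v))))
  ∂-walkChain {w = w} ((x , refl , refl) ◅ p) v = begin
    ∂ (walkChain ((x , refl , refl) ◅ p)) v
      ≡⟨ ∂-xor (λ e → does (edge x ≟ e)) (walkChain p) v ⟩
    ∂ (λ e → does (edge x ≟ e)) v xor ∂ (walkChain p) v
      ≡⟨ cong₂ _xor_ (∂-edge x v) (∂-walkChain p v) ⟩
    (X xor Y) xor (Y xor Z)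
      ≡⟨ solve 3 (λ x y z → (x :+ y) :+ (y :+ z) := x :+ z) refl X Y Z ⟩
    X xor Z ∎
    where
    open ≡-Reasoning
    open xor-∧-Solver
    X = does (vert x ≟ v)
    Y = does (vert (α x) ≟ v)
    Z = does (w ≟ v)

  module _ (s : Fin nF → Bool) (b : Fin nV) (flat : ∀ d → vert d ≡ b → s (face d) ≡ s (face (α d))) where
    -- Each turn by `σ` passes to the face across one edge at `b`, where `flat` forbids a change of
    -- `s`; the turns reach all darts at `b`.
    constant-at-vertex : ∀ x y → vert x ≡ b → vert y ≡ b → s (face x) ≡ s (face y)
    constant-at-vertex x y refl vy with Equivalence.to (vert-orb x y) (sym vy)
    ... | k , refl = along k
      where
      at-b : ∀ k → vert (iter σ k x) ≡ b
      at-b zero    = refl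
      at-b (suc k) = trans (vert-σ _) (at-b k)
      along : ∀ k → s (face x) ≡ s (face (iter σ k x))
      along zero    = refl
      along (suc k) = trans (along k) (trans (flat _ (at-b k)) (cong s (sym (face-σ _))))

  module _ (s : Fin nF → Bool) (flat : ∀ d → s (face d) ≡ s (face (α d))) where
    constant-along-walk : ∀ {u w} → Star Adjacent u w → ∀ x y → vert x ≡ u → vert y ≡ w → s (face x) ≡ s (face y)
    constant-along-walk ε x y vx vy = constant-at-vertex s _ (λ d _ → flat d) x y vx vy
    constant-along-walk ((d , refl , vd) ◅ p) x y vx vy =
      trans (constant-at-vertex s _ (λ d _ → flat d) x d vx refl)
        (trans (flat d) (constant-along-walk p (α d) y vd vy))

    -- Two darts of a component are joined by a walk. A component containing an isolated vertex is
    -- that vertex alone, since a walk leaving it would begin with a dart there.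
    constant-on-component : ∀ {c f g} → Touches c f → Touches c g → s f ≡ s g
    constant-on-component (inj₁ (x , refl , refl)) (inj₁ (y , eq , refl)) =
      constant-along-walk (Equivalence.to (comp-conn _ _) (sym eq)) x y refl refl
    constant-on-component (inj₁ (x , refl , refl)) (inj₂ (v , i , eq , refl))
      with Equivalence.to (comp-conn _ _) eq
    ... | ε                = contradiction refl (i x)
    ... | (d , vd , _) ◅ _ = contradiction vd (i d)
    constant-on-component (inj₂ (v , i , refl , refl)) (inj₁ (y , eq , refl))
      with Equivalence.to (comp-conn _ _) (sym eq)
    ... | ε                = contradiction refl (i y)
    ... | (d , vd , _) ◅ _ = contradiction vd (i d)
    constant-on-component (inj₂ (v , i , refl , refl)) (inj₂ (w , j , eq , refl))
      with Equivalence.to (comp-conn _ _) (sym eq)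
    ... | ε                = cong (s ∘ gf) (Equivalence.to (lfIso-inj v i v j) refl)
    ... | (d , vd , _) ◅ _ = contradiction vd (i d)

    -- A walk in the incidence graph alternates between faces and components, so it is consumed two
    -- steps at a time.
    constant-on-faces : ∀ {f g} → Star BStep (inj₂ f) (inj₂ g) → s f ≡ s g
    constant-on-faces ε = refl
    constant-on-faces (_◅_ {j = inj₁ c} cf (_◅_ {j = inj₂ h} ch p)) =
      trans (constant-on-component cf ch) (constant-on-faces p)

  -- Euler's formula and the bounding of cycles

  module _ (planar : IsPlanarMap M) where
    open IsPlanarMap planar

    -- Eliminating `nL` between `euler` and `tree-count` gives V + F = E + C + 1. In this form it
    -- says that the system below has exactly one more unknown than equations.
    euler-faces : nV + (nF + 1) ≡ suc (nE + (nC + 1))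
    euler-faces = +-cancelʳ-≡ nC _ _ (begin
      nV + (nF + 1) + nC        ≡⟨ solve 3 (λ v f c → v :+ (f :+ con 1) :+ c := v :+ (c :+ f) :+ con 1) refl nV nF nC ⟩
      nV + (nC + nF) + 1        ≡⟨ cong (λ l → nV + l + 1) tree-count ⟨
      nV + (nL + 1) + 1         ≡⟨ solve 2 (λ v l → v :+ (l :+ con 1) :+ con 1 := v :+ l :+ con 2) refl nV nL ⟩
      nV + nL + 2               ≡⟨ cong (_+ 2) euler ⟩
      nE + 2 * nC + 2           ≡⟨ solve 2 (λ e c → e :+ con 2 :* c :+ con 2 := con 1 :+ (e :+ (c :+ con 1)) :+ c) refl nE nC ⟩
      suc (nE + (nC + 1)) + nC  ∎)
      where
      open ≡-Reasoning
      open +-*-Solver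

    root : Fin nC → Fin nV
    root c = proj₁ (comp-surj c)

    toRoot : ∀ v → Star Adjacent v (root (comp v))
    toRoot v = Equivalence.to (comp-conn v (root (comp v))) (sym (proj₂ (comp-surj (comp v))))

    Unknown : Set
    Unknown = Fin nV ⊎ (Fin nF ⊎ Fin 1)

    Equation : Set
    Equation = Fin nE ⊎ (Fin nC ⊎ Fin 1)

    -- The linear system  Σ_v z_v (walk from v to its root) + δ s + t ξ = 0,
    -- z = 0 at the roots, s = 0 at f₀, has more unknowns than equations.
    module _ (f₀ : Fin nF) (ξ : EdgeChain) where

      walks : (Fin nV → Bool) → EdgeChain
      walks z e = ∑[ v < nV ] (z v ∧ walkChain (toRoot v) e)

      system : (Unknown → Bool) → Equation → Bool
      system g (inj₁ e)        = walks (g ∘ inj₁) e xor (δ (g ∘ inj₂ ∘ inj₁) e xor (g (inj₂ (inj₂ zero)) ∧ ξ e))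
      system g (inj₂ (inj₁ c)) = g (inj₁ (root c))
      system g (inj₂ (inj₂ _)) = g (inj₂ (inj₁ f₀))

      walks-xor : ∀ z z′ e → walks (λ v → z v xor z′ v) e ≡ walks z e xor walks z′ e
      walks-xor z z′ e = trans (sum-cong-≗ λ v → ∧-distribʳ-xor (walkChain (toRoot v) e) (z v) (z′ v))
        (∑-distrib-+ (λ v → z v ∧ walkChain (toRoot v) e) _)

      system-linear : ∀ g h x → system (λ a → g a xor h a) x ≡ system g x xor system h x
      system-linear g h (inj₁ e) = trans (cong (_xor rest) (walks-xor (g ∘ inj₁) (h ∘ inj₁) e))
        (solve 9 (λ w w′ a a′ b b′ t t′ x →
            (w :+ w′) :+ (((a :+ a′) :+ (b :+ b′)) :+ (t :+ t′) :* x)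
              := (w :+ ((a :+ b) :+ t :* x)) :+ (w′ :+ ((a′ :+ b′) :+ t′ :* x)))
          refl (walks (g ∘ inj₁) e) (walks (h ∘ inj₁) e)
               (g (inj₂ (inj₁ f))) (h (inj₂ (inj₁ f))) (g (inj₂ (inj₁ f′))) (h (inj₂ (inj₁ f′)))
               (g (inj₂ (inj₂ zero))) (h (inj₂ (inj₂ zero))) (ξ e))
        where
        open xor-∧-Solver
        f = face (dartOf e)
        f′ = face (α (dartOf e))
        rest = δ (λ f → g (inj₂ (inj₁ f)) xor h (inj₂ (inj₁ f))) e xor ((g (inj₂ (inj₂ zero)) xor h (inj₂ (inj₂ zero))) ∧ ξ e)
      system-linear g h (inj₂ (inj₁ c)) = refl
      system-linear g h (inj₂ (inj₂ _)) = refl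

      ∂-walks : ∀ z u → ∂ (walks z) u ≡ z u xor (∑[ v < nV ] (z v ∧ does (root (comp v) ≟ u)))
      ∂-walks z u = begin
        ∂ (walks z) u
          ≡⟨ ∂-∑ (λ v e → z v ∧ walkChain (toRoot v) e) u ⟩
        ∑[ v < nV ] ∂ (λ e → z v ∧ walkChain (toRoot v) e) u
          ≡⟨ sum-cong-≗ (λ v → trans (∂-scale (z v) (walkChain (toRoot v)) u) (cong (z v ∧_) (∂-walkChain (toRoot v) u))) ⟩
        ∑[ v < nV ] (z v ∧ (does (v ≟ u) xor does (root (comp v) ≟ u)))
          ≡⟨ sum-cong-≗ (λ v → trans (∧-distribˡ-xor (z v) (does (v ≟ u)) (at-root v)) (cong (_xor (z v ∧ at-root v)) (∧-comm (z v) (does (v ≟ u))))) ⟩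
        ∑[ v < nV ] ((does (v ≟ u) ∧ z v) xor (z v ∧ does (root (comp v) ≟ u)))
          ≡⟨ ∑-distrib-+ (λ v → does (v ≟ u) ∧ z v) _ ⟩
        (∑[ v < nV ] (does (v ≟ u) ∧ z v)) xor (∑[ v < nV ] (z v ∧ does (root (comp v) ≟ u)))
          ≡⟨ cong (_xor (∑[ v < nV ] (z v ∧ at-root v))) (∑-δ u z) ⟩
        z u xor (∑[ v < nV ] (z v ∧ does (root (comp v) ≟ u))) ∎
        where
        open ≡-Reasoning
        at-root : Fin nV → Bool
        at-root v = does (root (comp v) ≟ u)

      -- The walk from `v` has boundary `v` plus its root. A vertex that is not the root of its own
      -- component is the root of no vertex, so there the boundary of `walks z` reads off `z`.
      walks-independent : ∀ z → (∀ c → z (root c) ≡ false) → (∀ u → ∂ (walks z) u ≡ false) → ∀ u → z u ≡ false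
      walks-independent z z-root closed u with root (comp u) ≟ u
      ... | yes eq = trans (cong z (sym eq)) (z-root (comp u))
      ... | no root≢u = trans (xor≡false⇒≡ (trans (sym (∂-walks z u)) (closed u)))
              (∑-zero _ λ v → trans (cong (z v ∧_) (dec-false (root (comp v) ≟ u) (not-root v))) (∧-zeroʳ (z v)))
        where
        not-root : ∀ v → root (comp v) ≢ u
        not-root v refl = root≢u (cong root (proj₂ (comp-surj (comp v))))

      -- Take a nontrivial solution (z, s, t). Applying `∂` to the edge equations leaves `walks z`
      -- closed, so z = 0 and `δ s` = t ξ. If t were 0, then `s` would be constant on all faces and
      -- zero at `f₀`, making the solution trivial; hence t = 1.
      closed⇒coboundary : (∀ v → ∂ ξ v ≡ false) → ∃ λ s → ∀ e → δ s e ≡ ξ e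
      closed⇒coboundary closed
        with nontrivial-kernel ((↔-id _ ⊎-↔ +↔⊎) ↔-∘ +↔⊎) ((↔-id _ ⊎-↔ +↔⊎) ↔-∘ +↔⊎)
               (≤-reflexive (sym euler-faces)) system system-linear
      ... | g , g≢0 , sol = solution t refl
        where
        z = g ∘ inj₁
        s = g ∘ inj₂ ∘ inj₁
        t = g (inj₂ (inj₂ zero))

        rest-closed : ∀ u → ∂ (λ e → δ s e xor (t ∧ ξ e)) u ≡ false
        rest-closed u = trans (∂-xor (δ s) (λ e → t ∧ ξ e) u)
          (cong₂ _xor_ (∂δ≡0 s u) (trans (∂-scale t ξ u) (trans (cong (t ∧_) (closed u)) (∧-zeroʳ t))))

        z≡0 : ∀ v → z v ≡ false
        z≡0 = walks-independent z (λ c → sol (inj₂ (inj₁ c)))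
          λ u → trans (∂-cong {walks z} {λ e → δ s e xor (t ∧ ξ e)} (λ e → xor≡false⇒≡ (sol (inj₁ e))) u) (rest-closed u)

        δs≡tξ : ∀ e → δ s e ≡ t ∧ ξ e
        δs≡tξ e = xor≡false⇒≡ (trans (cong (_xor (δ s e xor (t ∧ ξ e))) (sym walks≡0)) (sol (inj₁ e)))
          where
          walks≡0 : walks z e ≡ false
          walks≡0 = ∑-zero _ λ v → cong (_∧ walkChain (toRoot v) e) (z≡0 v)

        solution : ∀ t′ → t ≡ t′ → ∃ λ s → ∀ e → δ s e ≡ ξ e
        solution true  t≡1 = s , λ e → trans (δs≡tξ e) (cong (_∧ ξ e) t≡1)
        solution false t≡0 = ⊥-elim (g≢0 vanishes)
          where
          flat : ∀ d → s (face d) ≡ s (face (α d))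
          flat d = xor≡false⇒≡ (trans (sym (δ-edge s d)) (trans (δs≡tξ (edge d)) (cong (_∧ ξ (edge d)) t≡0)))
          vanishes : ∀ a → g a ≡ false
          vanishes (inj₁ v)           = z≡0 v
          vanishes (inj₂ (inj₁ f))    = trans (constant-on-faces s flat (tree-conn (inj₂ f) (inj₂ f₀))) (sol (inj₂ (inj₂ zero)))
          vanishes (inj₂ (inj₂ zero)) = t≡0

-- Three linear orders

module Realizer {G : Set} (_≟ᴳ_ : DecidableEquality G) (_≤_ : G → G → Set) (dim≤3 : DimAtMost G _≤_ 3) where
  private
    L = proj₁ dim≤3
    total = proj₁ (proj₂ dim≤3)
    ≤⇔L = proj₂ (proj₂ dim≤3)
    module L i = IsTotalOrder (total i)

  ≤-refl : ∀ {x} → x ≤ x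
  ≤-refl {x} = Equivalence.from (≤⇔L x x) λ i → L.reflexive i refl

  -- Totality and antisymmetry decide each order once equality on `G` is decidable.
  L? : ∀ i x y → Dec (L i x y)
  L? i x y with x ≟ᴳ y | L.total i x y
  ... | yes refl | _        = yes (L.reflexive i refl)
  ... | no  _    | inj₁ xy  = yes xy
  ... | no  x≢y  | inj₂ yx  = no λ xy → x≢y (L.antisym i xy yx)

  State : Set
  State = G × G

  above : Fin 3 → State → Bool
  above i (x , y) = does (L? i y x)

  above-true : ∀ i {x y} → above i (x , y) ≡ true → L i y x
  above-true i {x} {y} eq with yes p ← L? i y x = p

  above-false : ∀ i {x y} → above i (x , y) ≡ false → L i x y
  above-false i {x} {y} eq with L? i y x | L.total i x y
  ... | no _    | inj₁ xy = xy
  ... | no ¬yx  | inj₂ yx = contradiction yx ¬yx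

  above-swap : ∀ i {x y} → x ≢ y → above i (x , y) ≡ not (above i (y , x))
  above-swap i {x} {y} x≢y = ¬-not λ eq → contra (above i (y , x)) eq refl
    where
    contra : ∀ b → above i (x , y) ≡ b → above i (y , x) ≡ b → ⊥
    contra true  p q = x≢y (L.antisym i (above-true i q) (above-true i p))
    contra false p q = x≢y (L.antisym i (above-false i p) (above-false i q))

  _≼_ : State → State → Set
  (x , y) ≼ (x′ , y′) = x ≤ x′ × y′ ≤ y

  above-mono : ∀ i {s t} → s ≼ t → above i s ≡ true → above i t ≡ true
  above-mono i {x , y} {x′ , y′} (x≤x′ , y′≤y) eq = dec-true (L? i y′ x′)
    (L.trans i (Equivalence.to (≤⇔L _ _) y′≤y i)
      (L.trans i (above-true i eq) (Equivalence.to (≤⇔L _ _) x≤x′ i)))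

  above-mono⁻ : ∀ i {s t} → s ≼ t → above i t ≡ false → above i s ≡ false
  above-mono⁻ i {s} s≼t t≡0 with above i s in s≡b
  ... | false = refl
  ... | true  = contradiction (trans (sym (above-mono i s≼t s≡b)) t≡0) λ()

  p q : State → Bool
  p = above 0F
  q = above 1F

  -- If both p and q changed from s to t, the third bit could neither be
  -- false at s (else s is a relation) nor true at t.
  not-both-change : ∀ {s t} → ¬ (proj₁ s ≤ proj₂ s) → ¬ (proj₂ t ≤ proj₁ t) → s ≼ t →
    q s ≡ false → q t ≡ true → ¬ (p s ≡ false × p t ≡ true)
  not-both-change {s} {t} s≰ t≱ s≼t qs qt (ps , pt) with above 2F s in rs
  ... | false = s≰ (Equivalence.from (≤⇔L _ _) λ where
    0F → above-false 0F ps
    1F → above-false 1F qs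
    2F → above-false 2F rs)
  ... | true = t≱ (Equivalence.from (≤⇔L _ _) λ where
    0F → above-true 0F pt
    1F → above-true 1F qt
    2F → above-true 2F (above-mono 2F s≼t rs))

  -- When `q` changes from `s` to `t`, `p` is constant on the whole interval: by monotonicity, two
  -- different values inside would force `p` to change from `s` to `t` as well.
  p-interval : ∀ {s t r r′} → ¬ (proj₁ s ≤ proj₂ s) → ¬ (proj₂ t ≤ proj₁ t) → s ≼ t →
    q s ≡ false → q t ≡ true → s ≼ r → r ≼ t → s ≼ r′ → r′ ≼ t → p r ≡ p r′
  p-interval {r = r} {r′ = r′} s≰ t≱ s≼t qs qt s≼r r≼t s≼r′ r′≼t with p r in pr | p r′ in pr′
  ... | true  | true  = refl
  ... | false | false = refl
  ... | true  | false = contradiction (above-mono⁻ 0F s≼r′ pr′ , above-mono 0F r≼t pr) (not-both-change s≰ t≱ s≼t qs qt)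
  ... | false | true  = contradiction (above-mono⁻ 0F s≼r pr , above-mono 0F r′≼t pr′) (not-both-change s≰ t≱ s≼t qs qt)

  -- Where `q` changes from `u` to `w`, it already changes from `(x , f)` to `(x , w)`, an interval
  -- containing `(x , e)`. So on the boundary of a face the coefficient of dq may be taken constant,
  -- which makes the form exact there.
  face-weight : ∀ {x u w e f} → u ≤ e → w ≤ e → e ≤ f → u ≤ f → w ≤ f → ¬ (x ≤ f) → ¬ (u ≤ x) → ¬ (w ≤ x) →
    p (x , e) ∧ (q (x , u) xor q (x , w)) ≡ p (x , f) ∧ (q (x , u) xor q (x , w))
  face-weight {x} {u} {w} {e} {f} ue we ef uf wf x≰f u≰x w≰x =
    ∧-xor-cong (change uf we wf w≰x) (λ qu qw → change wf ue uf u≰x qw qu)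
    where
    change : ∀ {a b} → a ≤ f → b ≤ e → b ≤ f → ¬ (b ≤ x) → q (x , a) ≡ false → q (x , b) ≡ true → p (x , e) ≡ p (x , f)
    change {a} {b} af be bf b≰x qa qb = p-interval {s = x , f} {t = x , b} x≰f b≰x (≤-refl , bf)
      (above-mono⁻ 1F {s = x , f} {t = x , a} (≤-refl , af) qa) qb (≤-refl , ef) (≤-refl , be) (≤-refl , ≤-refl) (≤-refl , bf)

  module _ {e g} (P Q : G → Set) (P≤e : ∀ {u} → P u → u ≤ e) (Q≤g : ∀ {v} → Q v → v ≤ g)
           (P≰g : ∀ {u} → P u → ¬ (u ≤ g)) (Q≰e : ∀ {v} → Q v → ¬ (v ≤ e)) where
    private
      -- A change of `q` between two corners of the square `e` × `g` forces one from `(u , g)` to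
      -- `(e , v′)`. The interval between these contains the centre `(e , g)`, so `p` may be read
      -- there.
      change : ∀ {u v u′ v′ r} → P u → Q v → P u′ → Q v′ → (u , g) ≼ r → r ≼ (e , v′) →
        q (u , v) ≡ false → q (u′ , v′) ≡ true → p r ≡ p (e , g)
      change {u} {v} {u′} {v′} Pu Qv Pu′ Qv′ s≼r r≼t q₀ q₁ =
        p-interval {s = u , g} {t = e , v′} (P≰g Pu) (Q≰e Qv′) (P≤e Pu , Q≤g Qv′)
          (above-mono⁻ 1F {s = u , g} {t = u , v} (≤-refl , Q≤g Qv) q₀)
          (above-mono 1F {s = u′ , v′} {t = e , v′} (P≤e Pu′ , ≤-refl) q₁)
          s≼r r≼t (P≤e Pu , ≤-refl) (≤-refl , Q≤g Qv′)

    cell-weight₁ : ∀ {u u′ v} → P u → P u′ → Q v →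
      p (e , v) ∧ (q (u , v) xor q (u′ , v)) ≡ p (e , g) ∧ (q (u , v) xor q (u′ , v))
    cell-weight₁ Pu Pu′ Qv = ∧-xor-cong
      (change Pu Qv Pu′ Qv (P≤e Pu , Q≤g Qv) (≤-refl , ≤-refl))
      (λ q₁ q₀ → change Pu′ Qv Pu Qv (P≤e Pu′ , Q≤g Qv) (≤-refl , ≤-refl) q₀ q₁)

    cell-weight₂ : ∀ {u v v′} → P u → Q v → Q v′ →
      p (u , g) ∧ (q (u , v) xor q (u , v′)) ≡ p (e , g) ∧ (q (u , v) xor q (u , v′))
    cell-weight₂ Pu Qv Qv′ = ∧-xor-cong
      (change Pu Qv Pu Qv′ (≤-refl , ≤-refl) (P≤e Pu , Q≤g Qv′))
      (λ q₁ q₀ → change Pu Qv′ Pu Qv (≤-refl , ≤-refl) (P≤e Pu , Q≤g Qv) q₀ q₁)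

    -- Closedness of p dq on the square `e` × `g`: once all four coefficients equal `p (e , g)`,
    -- both sides multiply it by the sum of `q` over the corners.
    cell : ∀ {u u′ v v′} → P u → P u′ → Q v → Q v′ →
      (p (e , v) ∧ (q (u , v) xor q (u′ , v))) xor (p (e , v′) ∧ (q (u , v′) xor q (u′ , v′)))
        ≡ (p (u , g) ∧ (q (u , v) xor q (u , v′))) xor (p (u′ , g) ∧ (q (u′ , v) xor q (u′ , v′)))
    cell {u} {u′} {v} {v′} Pu Pu′ Qv Qv′ = begin
      _ ≡⟨ cong₂ _xor_ (cell-weight₁ Pu Pu′ Qv) (cell-weight₁ Pu Pu′ Qv′) ⟩
      (P₀ ∧ (q (u , v) xor q (u′ , v))) xor (P₀ ∧ (q (u , v′) xor q (u′ , v′)))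
        ≡⟨ solve 5 (λ c w x y z → (c :* (w :+ x)) :+ (c :* (y :+ z)) := (c :* (w :+ y)) :+ (c :* (x :+ z)))
             refl P₀ (q (u , v)) (q (u′ , v)) (q (u , v′)) (q (u′ , v′)) ⟩
      (P₀ ∧ (q (u , v) xor q (u , v′))) xor (P₀ ∧ (q (u′ , v) xor q (u′ , v′)))
        ≡⟨ cong₂ _xor_ (cell-weight₂ Pu Qv Qv′) (cell-weight₂ Pu′ Qv Qv′) ⟨
      _ ∎
      where
      open ≡-Reasoning
      open xor-∧-Solver
      P₀ = p (e , g)

-- Moving two points along paths

module Motion (M : PlanarMap) (planar : IsPlanarMap M) (dim≤3 : DimAtMost (VEF M) (_≤VEF_ M) 3) where
  open PlanarMap M
  open Homology M
  open Realizer (≡-dec _≟_ (≡-dec _≟_ _≟_)) (_≤VEF_ M) dim≤3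

  pattern vertex v = inj₁ v
  pattern edge′ e  = inj₂ (inj₁ e)
  pattern face′ f  = inj₂ (inj₂ f)

  Endpoint : Fin nD → VEF M → Set
  Endpoint d x = x ≡ vertex (vert d) ⊎ x ≡ vertex (vert (α d))

  endpoint-below : ∀ {d x} → Endpoint d x → _≤VEF_ M x (edge′ (edge d))
  endpoint-below {d} (inj₁ refl) = d , refl , refl
  endpoint-below {d} (inj₂ refl) = α d , refl , edge-α d

  below-endpoint : ∀ {d v} → _≤VEF_ M (vertex v) (edge′ (edge d)) → Endpoint d (vertex v)
  below-endpoint {d} (x , refl , eq) with Equivalence.to (edge-orb d x) (sym eq)
  ... | inj₁ refl = inj₁ refl
  ... | inj₂ refl = inj₂ refl

  -- The integral of p dq while the first point crosses one edge and the second rests; `p` is read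
  -- in mid-move, when the moving point is the edge itself. `step₂` moves the second point instead.
  step₁ : Fin nD → Fin nV → Bool
  step₁ d y = p (edge′ (edge d) , vertex y) ∧ (q (vertex (vert d) , vertex y) xor q (vertex (vert (α d)) , vertex y))

  step₂ : Fin nV → Fin nD → Bool
  step₂ x d = p (vertex x , edge′ (edge d)) ∧ (q (vertex x , vertex (vert d)) xor q (vertex x , vertex (vert (α d))))

  step₂-α : ∀ x d → step₂ x (α d) ≡ step₂ x d
  step₂-α x d = cong₂ (λ e b → p (vertex x , edge′ e) ∧ b) (edge-α d)
    (trans (cong (λ d′ → q (vertex x , vertex (vert (α d))) xor q (vertex x , vertex (vert d′))) (α-invol d))
      (xor-comm (q (vertex x , vertex (vert (α d)))) _))

  -- Interchanging the points turns `p` into 1 + `p` and leaves dq unchanged, so the two integrals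
  -- add up to (1 + p) dq + p dq = dq.
  step-swap : ∀ d y → y ≢ vert d → y ≢ vert (α d) →
    step₁ d y xor step₂ y d ≡ q (vertex (vert d) , vertex y) xor q (vertex (vert (α d)) , vertex y)
  step-swap d y y≢u y≢w
    rewrite above-swap 0F {edge′ (edge d)} {vertex y} (λ ())
          | above-swap 1F {vertex (vert d)} {vertex y} (λ { refl → y≢u refl })
          | above-swap 1F {vertex (vert (α d))} {vertex y} (λ { refl → y≢w refl })
    = solve 3 (λ a b c → ((con true :+ a) :* ((con true :+ b) :+ (con true :+ c))) :+ (a :* (b :+ c))
                           := (con true :+ b) :+ (con true :+ c))
        refl (p (vertex y , edge′ (edge d))) (q (vertex y , vertex (vert d))) (q (vertex y , vertex (vert (α d))))
    where open xor-∧-Solver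

  step-cell : ∀ d d′ → (∀ {w} → Endpoint d w → ¬ Endpoint d′ w) →
    step₁ d (vert d′) xor step₁ d (vert (α d′)) ≡ step₂ (vert d) d′ xor step₂ (vert (α d)) d′
  step-cell d d′ disjoint = cell (Endpoint d) (Endpoint d′) endpoint-below endpoint-below
    (λ u u≤g → disjoint u (end≤ u u≤g)) (λ v v≤e → disjoint (end≤ v v≤e) v)
    (inj₁ refl) (inj₂ refl) (inj₁ refl) (inj₂ refl)
    where
    end≤ : ∀ {d d′ x} → Endpoint d x → _≤VEF_ M x (edge′ (edge d′)) → Endpoint d′ x
    end≤ (inj₁ refl) = below-endpoint
    end≤ (inj₂ refl) = below-endpoint

  module _ {s t : Fin nV} (A : Path M s t) where
    open Path A

    move₁ : Fin nV → Bool
    move₁ y = ∑[ i < len ] step₁ (darts i) y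

    move₂ : Fin nV → Bool
    move₂ x = ∑[ i < len ] step₂ x (darts i)

    pathChain : EdgeChain
    pathChain e = ∑[ i < len ] does (edge (darts i) ≟ e)

    endpoint-onPath : ∀ i {w} → Endpoint (darts i) (vertex w) → OnPath M A w
    endpoint-onPath i (inj₁ refl) = inject₁ i , sym (tail i)
    endpoint-onPath i (inj₂ refl) = suc i , sym (head i)

    path-telescope : (h : Fin nV → Bool) → ∑[ i < len ] (h (vert (darts i)) xor h (vert (α (darts i)))) ≡ h s xor h t
    path-telescope h = begin
      ∑[ i < len ] (h (vert (darts i)) xor h (vert (α (darts i))))
        ≡⟨ sum-cong-≗ (λ i → cong₂ (λ u w → h u xor h w) (tail i) (head i)) ⟩
      ∑[ i < len ] (h (vtx (inject₁ i)) xor h (vtx (suc i)))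
        ≡⟨ ∑-telescope len (h ∘ vtx) ⟩
      h (vtx zero) xor h (vtx (fromℕ len))
        ≡⟨ cong₂ (λ u w → h u xor h w) start end ⟩
      h s xor h t ∎
      where open ≡-Reasoning

    ∂-pathChain : ∀ v → ∂ pathChain v ≡ does (s ≟ v) xor does (t ≟ v)
    ∂-pathChain v = trans (∂-∑ (λ i e → does (edge (darts i) ≟ e)) v)
      (trans (sum-cong-≗ λ i → ∂-edge (darts i) v) (path-telescope λ u → does (u ≟ v)))

    pathChain-off : ∀ {b} → ¬ OnPath M A b → ∀ d → vert d ≡ b → pathChain (edge d) ≡ false
    pathChain-off {b} b∉A d refl = ∑-zero _ λ i → dec-false (edge (darts i) ≟ edge d)
      λ eq → b∉A (endpoint-onPath i (below-endpoint (d , refl , sym eq)))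

    -- This turns an integral along a path into a pairing with its edge chain, to which
    -- `winding-zero` applies. The dart chosen by `dartOf` is harmless because of `step₂-α`.
    ∑-pathChain : ∀ x → ∑[ e < nE ] (pathChain e ∧ step₂ x (dartOf e)) ≡ move₂ x
    ∑-pathChain x = begin
      ∑[ e < nE ] (pathChain e ∧ c e)
        ≡⟨ sum-cong-≗ (λ e → *-distribʳ-sum (c e) λ i → does (edge (darts i) ≟ e)) ⟩
      ∑[ e < nE ] ∑[ i < len ] (does (edge (darts i) ≟ e) ∧ c e)
        ≡⟨ ∑-comm (λ e i → does (edge (darts i) ≟ e) ∧ c e) ⟩
      ∑[ i < len ] ∑[ e < nE ] (does (edge (darts i) ≟ e) ∧ c e)
        ≡⟨ sum-cong-≗ (λ i → trans (sum-cong-≗ λ e → cong (_∧ c e) (≟-sym (edge (darts i)) e)) (∑-δ (edge (darts i)) c)) ⟩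
      ∑[ i < len ] c (edge (darts i))
        ≡⟨ sum-cong-≗ (λ i → dartOf-edge (step₂ x) (step₂-α x) (darts i)) ⟩
      move₂ x ∎
      where
      open ≡-Reasoning
      c : Fin nE → Bool
      c e = step₂ x (dartOf e)
      ≟-sym : ∀ {n} (i j : Fin n) → does (i ≟ j) ≡ does (j ≟ i)
      ≟-sym i j = does-⇔ (mk⇔ sym sym) (i ≟ j) (j ≟ i)

    move-swap : ∀ {y} → ¬ OnPath M A y → move₁ y xor move₂ y ≡ q (vertex s , vertex y) xor q (vertex t , vertex y)
    move-swap {y} y∉A = trans (sym (∑-distrib-+ (λ i → step₁ (darts i) y) λ i → step₂ y (darts i)))
      (trans (sum-cong-≗ λ i → step-swap (darts i) y
                (λ eq → y∉A (endpoint-onPath i (inj₁ (cong inj₁ eq))))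
                (λ eq → y∉A (endpoint-onPath i (inj₂ (cong inj₁ eq)))))
        (path-telescope λ u → q (vertex u , vertex y)))

  -- Green's theorem on the product of the paths: telescope along `B`, apply `step-cell` in every
  -- square, then telescope along `A`.
  rectangle : ∀ {s t s′ t′} (A : Path M s t) (B : Path M s′ t′) → (∀ w → OnPath M A w → ¬ OnPath M B w) →
    move₁ A s′ xor move₁ A t′ ≡ move₂ B s xor move₂ B t
  rectangle {s} {t} {s′} {t′} A B disjoint = begin
    move₁ A s′ xor move₁ A t′
      ≡⟨ ∑-distrib-+ (λ i → step₁ (A.darts i) s′) (λ i → step₁ (A.darts i) t′) ⟨
    ∑[ i < A.len ] (step₁ (A.darts i) s′ xor step₁ (A.darts i) t′)
      ≡⟨ sum-cong-≗ (λ i → path-telescope B (step₁ (A.darts i))) ⟨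
    ∑[ i < A.len ] ∑[ j < B.len ] (step₁ (A.darts i) (vert (B.darts j)) xor step₁ (A.darts i) (vert (α (B.darts j))))
      ≡⟨ sum-cong-≗ (λ i → sum-cong-≗ λ j → step-cell (A.darts i) (B.darts j) (separate i j)) ⟩
    ∑[ i < A.len ] ∑[ j < B.len ] (step₂ (vert (A.darts i)) (B.darts j) xor step₂ (vert (α (A.darts i))) (B.darts j))
      ≡⟨ ∑-comm (λ i j → step₂ (vert (A.darts i)) (B.darts j) xor step₂ (vert (α (A.darts i))) (B.darts j)) ⟩
    ∑[ j < B.len ] ∑[ i < A.len ] (step₂ (vert (A.darts i)) (B.darts j) xor step₂ (vert (α (A.darts i))) (B.darts j))
      ≡⟨ sum-cong-≗ (λ j → path-telescope A λ x → step₂ x (B.darts j)) ⟩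
    ∑[ j < B.len ] (step₂ s (B.darts j) xor step₂ t (B.darts j))
      ≡⟨ ∑-distrib-+ (λ j → step₂ s (B.darts j)) (λ j → step₂ t (B.darts j)) ⟩
    move₂ B s xor move₂ B t ∎
    where
    open ≡-Reasoning
    module A = Path A
    module B = Path B
    separate : ∀ i j {w} → Endpoint (A.darts i) w → ¬ Endpoint (B.darts j) w
    separate i j (inj₁ refl) e = disjoint _ (endpoint-onPath A i (inj₁ refl)) (endpoint-onPath B j e)
    separate i j (inj₂ refl) e = disjoint _ (endpoint-onPath A i (inj₂ refl)) (endpoint-onPath B j e)

  -- ξ bounds a set s of faces, which (after complementing) avoids b; on each of
  -- its faces the form p dq is exact, so that its integral along ξ vanishes.
  winding-zero : ∀ {b} d₀ → vert d₀ ≡ b → (ξ : EdgeChain) → (∀ v → ∂ ξ v ≡ false) →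
    (∀ d → vert d ≡ b → ξ (edge d) ≡ false) → ∑[ e < nE ] (ξ e ∧ step₂ b (dartOf e)) ≡ false
  winding-zero {b} d₀ refl ξ closed off
    with s , δs≡ξ ← closed⇒coboundary planar (face d₀) ξ closed
    = begin
    ∑[ e < nE ] (ξ e ∧ step₂ b (dartOf e))
      ≡⟨ sum-cong-≗ (λ e → trans (cong (_∧ step₂ b (dartOf e)) (sym (δs≡ξ e))) (two-sides (dartOf e))) ⟩
    ∑[ e < nE ] (side (dartOf e) xor side (α (dartOf e)))
      ≡⟨ ∑-darts side ⟩
    ∑[ d < nD ] side d
      ≡⟨ sum-cong-≗ exact ⟩
    ∑[ d < nD ] (potential d xor potential (σ (α d)))
      ≡⟨ ∑-distrib-+ potential (potential ∘ σ ∘ α) ⟩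
    (∑[ d < nD ] potential d) xor (∑[ d < nD ] potential (σ (α d)))
      ≡⟨ cong ((∑[ d < nD ] potential d) xor_) (∑-permute potential σα-perm) ⟨
    (∑[ d < nD ] potential d) xor (∑[ d < nD ] potential d)
      ≡⟨ xor-same (∑[ d < nD ] potential d) ⟩
    false ∎
    where
    open ≡-Reasoning
    open xor-∧-Solver using (solve; _:+_; _:*_; _:=_)

    -- Adding a constant complements `s` if necessary, so that the face of `d₀` lies outside,
    -- without changing which edges bound it.
    s′ : Fin nF → Bool
    s′ f = s f xor s (face d₀)

    side potential : Fin nD → Bool
    side d = s′ (face d) ∧ step₂ b d
    -- On a face `f` in the set, p dq has the constant coefficient p(b, f) and hence this primitive,
    -- read at the vertex of `d`. Its differences along the orbits of `σ ∘ α` cancel.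
    potential d = s′ (face d) ∧ (p (vertex b , face′ (face d)) ∧ q (vertex b , vertex (vert d)))

    two-sides : ∀ d → (s (face d) xor s (face (α d))) ∧ step₂ b d ≡ side d xor side (α d)
    two-sides d = trans
      (solve 4 (λ x y z c → (x :+ y) :* c := ((x :+ z) :* c) :+ ((y :+ z) :* c))
        refl (s (face d)) (s (face (α d))) (s (face d₀)) (step₂ b d))
      (cong (λ c → side d xor (s′ (face (α d)) ∧ c)) (sym (step₂-α b d)))

    flat : ∀ d → vert d ≡ b → s (face d) ≡ s (face (α d))
    flat d at-b = xor≡false⇒≡ (trans (sym (δ-edge s d)) (trans (δs≡ξ (edge d)) (off d at-b)))

    avoids-b : ∀ f → s′ f ≡ true → ¬ VertFace M b f
    avoids-b f in-s (inj₁ (x , at-b , refl)) = contradiction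
      (trans (sym in-s) (trans (cong (_xor s (face d₀)) (constant-at-vertex s b flat x d₀ at-b refl)) (xor-same (s (face d₀)))))
      λ()
    avoids-b f in-s (inj₂ (isolated , _)) = isolated d₀ refl

    next-face : ∀ d → face (σ (α d)) ≡ face d
    next-face d = trans (face-σ (α d)) (cong face (α-invol d))

    potential-next : ∀ d → potential (σ (α d)) ≡
      s′ (face d) ∧ (p (vertex b , face′ (face d)) ∧ q (vertex b , vertex (vert (α d))))
    potential-next d = cong₂ (λ f v → s′ f ∧ (p (vertex b , face′ f) ∧ q (vertex b , vertex v))) (next-face d) (vert-σ (α d))

    weight : ∀ d → ¬ VertFace M b (face d) →
      step₂ b d ≡ p (vertex b , face′ (face d)) ∧ (q (vertex b , vertex (vert d)) xor q (vertex b , vertex (vert (α d))))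
    weight d b∉f = face-weight {vertex b} {vertex (vert d)} {vertex (vert (α d))} {edge′ (edge d)} {face′ (face d)}
      (endpoint-below (inj₁ refl)) (endpoint-below (inj₂ refl)) (d , refl , refl)
      here there b∉f (λ eq → b∉f (subst On-face eq here)) (λ eq → b∉f (subst On-face eq there))
      where
      On-face : Fin nV → Set
      On-face v = VertFace M v (face d)
      here : On-face (vert d)
      here = inj₁ (d , refl , refl)
      -- The next dart of the face boundary, `σ (α d)`, starts at the far end of `d`.
      there : On-face (vert (α d))
      there = inj₁ (σ (α d) , vert-σ (α d) , next-face d)

    exact : ∀ d → side d ≡ potential d xor potential (σ (α d))
    exact d rewrite potential-next d with s′ (face d) in in-s
    ... | false = refl
    ... | true  = trans (weight d (avoids-b (face d) in-s)) (∧-distribˡ-xor (p (vertex b , face′ (face d))) _ _)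

  -- Exchanging two points on the theta graph

  module _ (H : SubdivK23 M) where
    open SubdivK23 H

    a-off : ∀ {i i′} j → i ≢ i′ → ¬ OnPath M (P i′ j) (a i)
    a-off {i} {i′} j i≢i′ on = proj₁ (internal i′ j (a i) on (i≢i′ ∘ a-inj i i′) (a≢b i j)) i refl

    b-off : ∀ i {j j′} → j ≢ j′ → ¬ OnPath M (P i j′) (b j)
    b-off i {j} {j′} j≢j′ on = proj₁ (proj₂ (internal i j′ (b j) on (a≢b i j ∘ sym) (j≢j′ ∘ b-inj j j′))) j refl

    disjoint : ∀ {i i′ j j′} → i ≢ i′ → j ≢ j′ → ∀ w → OnPath M (P i j) w → ¬ OnPath M (P i′ j′) w
    disjoint {i} {i′} {j} {j′} i≢i′ j≢j′ w on on′ with w ≟ a i | w ≟ b j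
    ... | yes refl | _        = a-off j′ i≢i′ on′
    ... | no  _    | yes refl = b-off i′ j≢j′ on′
    ... | no  w≢a  | no  w≢b  = proj₂ (proj₂ (internal i j w on w≢a w≢b)) i′ j′ (λ eq → i≢i′ (sym (proj₁ eq))) on′

    -- The integral of p dq while the points at a₀ and a₁ change places, the first
    -- one along the path through b j (where it waits) and the second through b k.
    exchange : Fin 3 → Fin 3 → Bool
    exchange j k = (move₁ (P 0F j) (a 1F) xor move₁ (P 1F j) (a 0F)) xor (move₂ (P 0F k) (b j) xor move₂ (P 1F k) (b j))

    -- The last dart of a path to `b j`, reversed; the path is not empty because `a≢b`. It supplies
    -- the face from which `winding-zero` normalizes its face set.
    dart-at-b : ∀ j → ∃ λ d → vert d ≡ b j
    dart-at-b j = last (P 0F j)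
      where
      last : Path M (a 0F) (b j) → ∃ λ d → vert d ≡ b j
      last record { len = zero ; start = start ; end = end } = contradiction (trans (sym start) end) (a≢b 0F j)
      last record { len = suc n ; darts = darts ; head = head ; end = end } = α (darts (fromℕ n)) , trans (head (fromℕ n)) end

    -- The two exchanges differ only in the walk of the second point. Together these walks form a
    -- closed chain through `b k` and `b l` that misses `b j`, and the integral along it vanishes.
    exchange-indep : ∀ {j k l} → j ≢ k → j ≢ l → exchange j k ≡ exchange j l
    exchange-indep {j} {k} {l} j≢k j≢l = cong ((move₁ (P 0F j) (a 1F) xor move₁ (P 1F j) (a 0F)) xor_)
      (xor≡false⇒≡ (trans (sym sum≡moves) (winding-zero (proj₁ (dart-at-b j)) (proj₂ (dart-at-b j)) ξ closed off)))
      where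
      open xor-∧-Solver
      ξ₀ ξ₁ η₀ η₁ ξ : EdgeChain
      ξ₀ = pathChain (P 0F k)
      ξ₁ = pathChain (P 1F k)
      η₀ = pathChain (P 0F l)
      η₁ = pathChain (P 1F l)
      ξ e = (ξ₀ e xor ξ₁ e) xor (η₀ e xor η₁ e)

      closed : ∀ v → ∂ ξ v ≡ false
      closed v = begin
        ∂ ξ v
          ≡⟨ ∂-xor (λ e → ξ₀ e xor ξ₁ e) (λ e → η₀ e xor η₁ e) v ⟩
        ∂ (λ e → ξ₀ e xor ξ₁ e) v xor ∂ (λ e → η₀ e xor η₁ e) v
          ≡⟨ cong₂ _xor_ (∂-xor ξ₀ ξ₁ v) (∂-xor η₀ η₁ v) ⟩
        (∂ ξ₀ v xor ∂ ξ₁ v) xor (∂ η₀ v xor ∂ η₁ v)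
          ≡⟨ cong₂ _xor_ (cong₂ _xor_ (∂-pathChain (P 0F k) v) (∂-pathChain (P 1F k) v))
                         (cong₂ _xor_ (∂-pathChain (P 0F l) v) (∂-pathChain (P 1F l) v)) ⟩
        -- Every endpoint is shared by two of the four paths.
        _ ≡⟨ solve 4 (λ x y z w → ((x :+ z) :+ (y :+ z)) :+ ((x :+ w) :+ (y :+ w)) := con false) refl
               (does (a 0F ≟ v)) (does (a 1F ≟ v)) (does (b k ≟ v)) (does (b l ≟ v)) ⟩
        false ∎
        where open ≡-Reasoning

      off : ∀ d → vert d ≡ b j → ξ (edge d) ≡ false
      off d at-b = cong₂ _xor_
        (cong₂ _xor_ (pathChain-off (P 0F k) (b-off 0F j≢k) d at-b) (pathChain-off (P 1F k) (b-off 1F j≢k) d at-b))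
        (cong₂ _xor_ (pathChain-off (P 0F l) (b-off 0F j≢l) d at-b) (pathChain-off (P 1F l) (b-off 1F j≢l) d at-b))

      c : Fin nE → Bool
      c e = step₂ (b j) (dartOf e)

      sum≡moves : ∑[ e < nE ] (ξ e ∧ c e) ≡
        (move₂ (P 0F k) (b j) xor move₂ (P 1F k) (b j)) xor (move₂ (P 0F l) (b j) xor move₂ (P 1F l) (b j))
      sum≡moves = trans (∑-split (λ e → ξ₀ e xor ξ₁ e) (λ e → η₀ e xor η₁ e))
        (cong₂ _xor_
          (trans (∑-split ξ₀ ξ₁) (cong₂ _xor_ (∑-pathChain (P 0F k) (b j)) (∑-pathChain (P 1F k) (b j))))
          (trans (∑-split η₀ η₁) (cong₂ _xor_ (∑-pathChain (P 0F l) (b j)) (∑-pathChain (P 1F l) (b j)))))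
        where
        ∑-split : ∀ (x y : EdgeChain) → ∑[ e < nE ] ((x e xor y e) ∧ c e) ≡ (∑[ e < nE ] (x e ∧ c e)) xor (∑[ e < nE ] (y e ∧ c e))
        ∑-split x y = trans (sum-cong-≗ λ e → ∧-distribʳ-xor (c e) (x e) (y e)) (∑-distrib-+ (λ e → x e ∧ c e) (λ e → y e ∧ c e))

    -- Both sides sweep the same two rectangles; swapping the roles of the points
    -- replaces p by its negation, and ∫ dq = 1 from (a₀ , a₁) to (a₁ , a₀).
    exchange-opposite : ∀ {j k} → j ≢ k → exchange k j ≡ not (exchange j k)
    exchange-opposite {j} {k} j≢k = xor≡false⇒≡ (begin
      exchange k j xor not (exchange j k)
        -- The four integrals `x₁` to `x₄` are inserted twice each, to complete the given terms to
        -- two rectangles and four instances of `move-swap`.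
        ≡⟨ solve 12 (λ m₁ m₂ m₃ m₄ n₁ n₂ n₃ n₄ x₁ x₂ x₃ x₄ →
             ((m₁ :+ m₂) :+ (m₃ :+ m₄)) :+ (con true :+ ((n₁ :+ n₂) :+ (n₃ :+ n₄)))
             := ((m₁ :+ x₁) :+ (x₃ :+ m₄)) :+ (((m₂ :+ x₂) :+ (x₄ :+ m₃))
                :+ (((x₁ :+ n₃) :+ (x₂ :+ n₄)) :+ (((n₂ :+ x₃) :+ (n₁ :+ x₄)) :+ con true))))
             refl
             (move₁ (P 0F k) (a 1F)) (move₁ (P 1F k) (a 0F)) (move₂ (P 0F j) (b k)) (move₂ (P 1F j) (b k))
             (move₁ (P 0F j) (a 1F)) (move₁ (P 1F j) (a 0F)) (move₂ (P 0F k) (b j)) (move₂ (P 1F k) (b j))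
             (move₁ (P 0F k) (b j)) (move₁ (P 1F k) (b j)) (move₂ (P 1F j) (a 0F)) (move₂ (P 0F j) (a 1F)) ⟩
      _ ≡⟨ cong₂ _xor_ (rect 0F 1F λ()) (cong₂ _xor_ (rect 1F 0F λ()) (cong₂ _xor_
             (cong₂ _xor_ (move-swap (P 0F k) (b-off 0F j≢k)) (move-swap (P 1F k) (b-off 1F j≢k)))
             (cong (_xor true) (cong₂ _xor_ (move-swap (P 1F j) (a-off j λ())) (move-swap (P 0F j) (a-off j λ())))))) ⟩
      ((q (A₀ , Bⱼ) xor q (Bₖ , Bⱼ)) xor (q (A₁ , Bⱼ) xor q (Bₖ , Bⱼ)))
        xor (((q (A₁ , A₀) xor q (Bⱼ , A₀)) xor (q (A₀ , A₁) xor q (Bⱼ , A₁))) xor true)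
        ≡⟨ solve 7 (λ x y z w u v t → ((x :+ z) :+ (y :+ z)) :+ (((w :+ u) :+ (t :+ v)) :+ con true)
                      := (x :+ u) :+ ((y :+ v) :+ ((t :+ w) :+ con true))) refl
             (q (A₀ , Bⱼ)) (q (A₁ , Bⱼ)) (q (Bₖ , Bⱼ)) (q (A₁ , A₀)) (q (Bⱼ , A₀)) (q (Bⱼ , A₁)) (q (A₀ , A₁)) ⟩
      (q (A₀ , Bⱼ) xor q (Bⱼ , A₀)) xor ((q (A₁ , Bⱼ) xor q (Bⱼ , A₁)) xor ((q (A₀ , A₁) xor q (A₁ , A₀)) xor true))
        -- Three transposed pairs contribute 1 each; with the remaining `true` they sum to 4, which
        -- is 0 modulo 2.
        ≡⟨ cong₂ _xor_ (q-swap (a≢b 0F j)) (cong₂ _xor_ (q-swap (a≢b 1F j)) (cong (_xor true) (q-swap a₀≢a₁))) ⟩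
      false ∎)
      where
      open ≡-Reasoning
      open xor-∧-Solver
      A₀ A₁ Bⱼ Bₖ : VEF M
      A₀ = vertex (a 0F)
      A₁ = vertex (a 1F)
      Bⱼ = vertex (b j)
      Bₖ = vertex (b k)

      rect : ∀ i i′ → i ≢ i′ →
        (move₁ (P i k) (a i′) xor move₁ (P i k) (b j)) xor (move₂ (P i′ j) (a i) xor move₂ (P i′ j) (b k)) ≡ false
      rect i i′ i≢i′ = trans (cong (_xor swept) (rectangle (P i k) (P i′ j) (disjoint i≢i′ (j≢k ∘ sym)))) (xor-same swept)
        where swept = move₂ (P i′ j) (a i) xor move₂ (P i′ j) (b k)

      q-swap : ∀ {x y} → x ≢ y → q (vertex x , vertex y) xor q (vertex y , vertex x) ≡ true
      q-swap {x} {y} x≢y = trans (cong (_xor q (vertex y , vertex x)) (above-swap 1F {vertex x} {vertex y} λ { refl → x≢y refl }))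
        (solve 1 (λ b → (con true :+ b) :+ b := con true) refl (q (vertex y , vertex x)))

      a₀≢a₁ : a 0F ≢ a 1F
      a₀≢a₁ eq with () ← a-inj 0F 1F eq

    -- Going once round the three waiting places negates the integral three times, an odd number,
    -- yet returns to the initial value.
    no-realizer : ⊥
    no-realizer = not-¬ {exchange 2F 1F} refl (begin
      exchange 2F 1F        ≡⟨ exchange-indep (λ()) (λ()) ⟩
      exchange 2F 0F        ≡⟨ exchange-opposite (λ()) ⟩
      not (exchange 0F 2F)  ≡⟨ cong not (exchange-indep (λ()) (λ())) ⟩
      not (exchange 0F 1F)  ≡⟨ exchange-opposite (λ()) ⟨
      exchange 1F 0F        ≡⟨ exchange-indep (λ()) (λ()) ⟩
      exchange 1F 2F        ≡⟨ exchange-opposite (λ()) ⟩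
      not (exchange 2F 1F)  ∎)
      where open ≡-Reasoning

theorem2p3 : (M : PlanarMap) → IsPlanarMap M → SubdivK23 M →
    ¬ DimAtMost (VEF M) (_≤VEF_ M) 3
theorem2p3 M planar H dim≤3 = Motion.no-realizer M planar dim≤3 H
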